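{- Let $m \equiv 3 \pmod 4$ and $n \equiv 1 \pmod 4$ be two distinct square-free positive integers, and let $K = \mathbb{Q}(\sqrt{ -m},\sqrt{n})$. Then $$ g(\mathcal{O}_K) \leq \begin{cases} s(\mathcal{O}_K)+1 & \text{if } s(\mathcal{O}_K) \text{ is even},\\ s(\mathcal{O}_K)+2 & \text{if } s(\mathcal{O}_K) \text{ is odd}.\end{cases} $$
   Context: For a number field $K$, $\mathcal{O}_K$ denotes its ring of integers. $s(\mathcal{O}_K)$ is the minimal number of squares required to represent $-1$ in $\mathcal{O}_K$, i.e. the smallest positive integer $s$ such that $-1$ is a sum of $s$ squares of elements of $\mathcal{O}_K$. $g(\mathcal{O}_K)$ is the smallest positive integer $t$ such that every element of $\mathcal{O}_K$ is a sum of $t$ squares of elements of $\mathcal{O}_K$ (zero summands allowed); the asserted inequality includes the existence of such a $t$. -}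

module Defs where

open import Algebra.Apartness.Bundles using (HeytingField)
open import Algebra.Bundles using (CommutativeRing)
open import Algebra.Bundles.Raw using (RawRing)
import Algebra.Definitions.RawSemiring as RawSemiringDefinitions
open import Algebra.Morphism.Structures using (IsRingHomomorphism)
open import Data.Fin.Base using (toℕ)
open import Data.Integer.Base using (ℤ)
open import Data.Nat.Base as ℕ using (ℕ; _≤_; _<_)
open import Data.Nat.Divisibility using (_∣_)
open import Data.Product.Base using (∃-syntax; Σ-syntax; _×_)
open import Data.Rational.Base as ℚ using (ℚ)
open import Data.Vec.Functional using (Vector)
open import Level using (Level; suc; _⊔_)
open import Relation.Binary.PropositionalEquality.Core using (_≡_)
open import Relation.Nullary.Negation.Core using (¬_)

Squarefree : ℕ → Set
Squarefree n = ∀ d → d ℕ.* d ∣ n → d ≡ 1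

IsLeastPositive : ∀ {p} → (ℕ → Set p) → ℕ → Set p
IsLeastPositive P k = 0 < k × P k × (∀ j → 0 < j → P j → k ≤ j)

-- "The least positive integer satisfying P exists and is at most b."  For an
-- undecidable P the least witness cannot be computed from a witness, so its
-- existence is asserted under a double negation; the existence of some
-- witness bounded by b is asserted constructively.  Classically the two
-- components are equivalent.
LeastPositive≤ : ∀ {p} → (ℕ → Set p) → ℕ → Set p
LeastPositive≤ P b =
    (∃[ t ] (0 < t × t ≤ b × P t))
  × ¬ ¬ (∃[ g ] (IsLeastPositive P g × g ≤ b))

-- The library's HeytingField has an apartness relation in which every x
-- apart from 0 is invertible; classically this is just a field.  Since
-- 1 is apart from 0 in it, ι is automatically injective.
record FieldOverℚ (c ℓ₁ ℓ₂ : Level) : Set (suc (c ⊔ ℓ₁ ⊔ ℓ₂)) where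
  field
    heytingField : HeytingField c ℓ₁ ℓ₂

  open HeytingField heytingField public

  commutativeRing : CommutativeRing c ℓ₁
  commutativeRing = record { isCommutativeRing = isCommutativeRing }

  open CommutativeRing commutativeRing public using (rawRing)

  field
    ι                    : ℚ → Carrier
    ι-isRingHomomorphism : IsRingHomomorphism ℚ.+-*-rawRing rawRing ι

  open RawSemiringDefinitions (RawRing.rawSemiring rawRing) public
    using (_^_; sum)

  fromℤ : ℤ → Carrier
  fromℤ z = ι (z ℚ./ 1)

module _ {c ℓ₁ ℓ₂ : Level} (K : FieldOverℚ c ℓ₁ ℓ₂) where

  open FieldOverℚ K

  -- The smallest subfield of K containing u and v, i.e. ℚ(u , v).
  data ℚ⟨_,_⟩ (u v : Carrier) : Carrier → Set (c ⊔ ℓ₁) where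
    rational : ∀ q → ℚ⟨ u , v ⟩ (ι q)
    left     : ℚ⟨ u , v ⟩ u
    right    : ℚ⟨ u , v ⟩ v
    add      : ∀ {x y} → ℚ⟨ u , v ⟩ x → ℚ⟨ u , v ⟩ y → ℚ⟨ u , v ⟩ (x + y)
    neg      : ∀ {x} → ℚ⟨ u , v ⟩ x → ℚ⟨ u , v ⟩ (- x)
    mul      : ∀ {x y} → ℚ⟨ u , v ⟩ x → ℚ⟨ u , v ⟩ y → ℚ⟨ u , v ⟩ (x * y)
    inv      : ∀ {x y} → x * y ≈ 1# → ℚ⟨ u , v ⟩ x → ℚ⟨ u , v ⟩ y
    resp     : ∀ {x y} → x ≈ y → ℚ⟨ u , v ⟩ x → ℚ⟨ u , v ⟩ y

  -- K = ℚ(√a , √b).  The roots are only determined up to sign, which does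
  -- not affect the field they generate.  Nothing prevents √a or √b from being
  -- rational, in which case K has degree less than 4.
  record IsℚAdjoinSquareRoots (a b : ℤ) : Set (c ⊔ ℓ₁) where
    field
      √a √b     : Carrier
      √a-square : √a * √a ≈ fromℤ a
      √b-square : √b * √b ≈ fromℤ b
      generate  : ∀ x → ℚ⟨ √a , √b ⟩ x

  -- Membership in 𝒪_K: x is a root of the monic polynomial
  -- X^d + a_{d-1} X^{d-1} + … + a_0 with integer coefficients.
  Integral : Carrier → Set ℓ₁
  Integral x =
    Σ[ d ∈ ℕ ] Σ[ a ∈ Vector ℤ d ]
      x ^ d + sum (λ i → fromℤ (a i) * x ^ toℕ i) ≈ 0#

  IsSumOfIntegralSquares : ℕ → Carrier → Set (c ⊔ ℓ₁)
  IsSumOfIntegralSquares k x =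
    Σ[ y ∈ Vector Carrier k ] ((∀ i → Integral (y i)) × x ≈ sum (λ i → y i * y i))

  -- s(𝒪_K) = s, as a relation.
  IsLevel : ℕ → Set (c ⊔ ℓ₁)
  IsLevel = IsLeastPositive λ k → IsSumOfIntegralSquares k (- 1#)

  -- g(𝒪_K) ≤ b, where g(𝒪_K) is the least positive t such that every element
  -- of 𝒪_K is a sum of t squares in 𝒪_K.
  g≤ : ℕ → Set (c ⊔ ℓ₁)
  g≤ = LeastPositive≤ λ t → ∀ x → Integral x → IsSumOfIntegralSquares t x

{-# OPTIONS --safe #-}

-- Let α = (1 + √-m)/2 and β = (1 + √n)/2; both satisfy x² = x + integer, so
-- y⁴ ≡ y modulo 2 on the order ℤ[α , β].  If 2w lies in the order and w is
-- integral of degree d, then (2w)ᵈ is even there, hence so is 2w, hence w lies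
-- in the order.  Every x in K has a positive multiple in the order, and for
-- integral x this makes some odd multiple D x lie in it; then x⁴ ≡ x modulo
-- 2𝒪_K, so every element of 𝒪_K is a square modulo 2.  Finally, -1 being a sum
-- of an even number k of squares makes the sum of k + 1 squares an isotropic
-- form, and translating along an isotropic vector corrects a representation
-- modulo 2 to an exact one.

module Submission where

open import Algebra.Bundles using (CommutativeRing)
open import Algebra.Morphism.Structures using (IsRingHomomorphism)
import Algebra.Properties.CommutativeSemiring.Exp as Exp
import Algebra.Properties.Ring as RingProperties
import Algebra.Properties.Semiring.Sum as Sum
import Algebra.Solver.Ring as RingSolver
open import Algebra.Solver.Ring.AlmostCommutativeRing
  using (fromCommutativeRing; _-Raw-AlmostCommutative⟶_)
open import Data.Fin.Base using (Fin; zero; suc; toℕ; fromℕ<; combine; remQuot)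
open import Data.Fin.Properties using (toℕ<n; toℕ-fromℕ<; remQuot-combine)
open import Data.Integer.Base as ℤ using (ℤ; +_; -[1+_])
import Data.Integer.Properties as ℤ
import Data.Integer.Solver as ℤ
import Data.Maybe.Base as Maybe
open import Data.Nat.Base as ℕ using (ℕ; zero; suc; _<_; _≤_)
open import Data.Nat.Divisibility using (_∣_; divides)
open import Data.Nat.DivMod using (_/_; m≡m%n+[m/n]*n)
open import Data.Nat.Induction using (<-wellFounded)
import Data.Nat.Properties as ℕ
open import Data.Product.Base
  using (Σ-syntax; ∃-syntax; _×_; _,_; proj₁; proj₂; uncurry)
open import Data.Rational.Base as ℚ using (mkℚ)
import Data.Rational.Properties as ℚ
open import Data.Rational.Unnormalised.Base as ℚᵘ using (ℚᵘ; mkℚᵘ; *≡*)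
import Data.Rational.Unnormalised.Properties as ℚᵘ
open import Data.Sum.Base using (_⊎_; inj₁; inj₂)
open import Data.Vec.Functional using (Vector; _∷_; replicate)
open import Function.Base using (_∘_)
open import Induction.WellFounded using (Acc; acc)
open import Level using (Level; _⊔_)
open import Relation.Binary.PropositionalEquality.Core as ≡ using (_≡_; _≢_)
import Relation.Binary.Reasoning.Setoid as SetoidReasoning
open import Relation.Nullary.Decidable.Core using (dec⇒maybe)
open import Relation.Nullary.Negation.Core using (¬_; contradiction)

-- Integrality is given as a bare monic equation, so closure of the integral elements under sums and
-- products has to be earned. It comes from the determinant trick: an element that stabilises a
-- finitely generated module containing 1 is integral. Equality in `K` is not decidable, so
-- arithmetic case distinctions are made on integers only: the parity of a multiplier, the sign of a
-- constant coefficient. For the same reason the order is a closure predicate instead of a set of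
-- coordinates in a basis, and its properties follow by induction on how an element is built.
-- Elements of `K` are built with inverses, and no conjugation is at hand to rationalise them; an
-- integral equation of the element to be inverted takes the place of its norm. The two cases of the
-- bound are one: an odd level `s` is padded with a zero square to the even length `s + 1`, whence
-- `s + 2` instead of `s + 1`.

parity : ∀ n → ∃[ e ] (n ≡ e ℕ.+ e ⊎ n ≡ suc (e ℕ.+ e))
parity zero = 0 , inj₁ ≡.refl
parity (suc n) with parity n
... | e , inj₁ eq = e , inj₂ (≡.cong suc eq)
... | e , inj₂ eq = suc e , inj₁ (≡.cong suc (≡.trans eq (≡.sym (ℕ.+-suc e e))))

-- Integer coefficients, submodules over ℤ and spans

module Integrality {c ℓ : Level} (R : CommutativeRing c ℓ)
  (φ : ℤ → CommutativeRing.Carrier R)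
  (φ-hom : IsRingHomomorphism ℤ.+-*-rawRing (CommutativeRing.rawRing R) φ) where

  open CommutativeRing R hiding (zero)
  open Exp commutativeSemiring using (_^_; ^-congˡ; ^-congʳ; ^-homo-*; ^-distrib-*)
  open Sum semiring
    using (sum; sum-cong-≋; ∑-distrib-+; *-distribˡ-sum; sum-replicate-zero)
  open RingProperties ring using (-‿involutive)
  open SetoidReasoning setoid
  private module φ = IsRingHomomorphism φ-hom

  private
    φ-morphism : ℤ.+-*-rawRing -Raw-AlmostCommutative⟶ fromCommutativeRing R
    φ-morphism = record
      { ⟦_⟧    = φ
      ; +-homo = φ.+-homo
      ; *-homo = φ.*-homo
      ; -‿homo = φ.-‿homo
      ; 0-homo = φ.0#-homo
      ; 1-homo = φ.1#-homo
      }

  -- Coefficients are normalised in ℤ, where equality is decidable, and only then mapped by `φ`;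
  -- equality in `R` need not be decidable.
  module Solver = RingSolver ℤ.+-*-rawRing (fromCommutativeRing R) φ-morphism
    (λ i j → Maybe.map (reflexive ∘ ≡.cong φ) (dec⇒maybe (i ℤ.≟ j)))

  open Solver using (solve; con; _:=_; _:+_; _:*_; _:-_; :-_; _:^_)

  -- A solver expression denoting 1# (con (+ 1) denotes φ 1).
  :1 : ∀ {n} → Solver.Polynomial n
  :1 = con (+ 0) :^ 0

  record IsSubmodule {p} (P : Carrier → Set p) : Set (c ⊔ ℓ ⊔ p) where
    field
      resp∈ : ∀ {x y} → x ≈ y → P x → P y
      zero∈ : P 0#
      add∈ : ∀ {x y} → P x → P y → P (x + y)
      scale∈ : ∀ k {x} → P x → P (φ k * x)

    neg∈ : ∀ {x} → P x → P (- x)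
    neg∈ {x} px =
      resp∈ (solve 1 (λ x → con (ℤ.- (+ 1)) :* x := :- x) refl x) (scale∈ (ℤ.- (+ 1)) px)

    sum∈ : ∀ {n} (e : Vector Carrier n) → (∀ i → P (e i)) → P (sum e)
    sum∈ {zero} e pe = zero∈
    sum∈ {suc n} e pe = add∈ (pe zero) (sum∈ (e ∘ suc) (pe ∘ suc))

  Span : ∀ {n} → Vector Carrier n → Carrier → Set ℓ
  Span {n} e z = Σ[ a ∈ Vector ℤ n ] z ≈ sum (λ i → φ (a i) * e i)

  sum-cong : ∀ {n} (f g : Vector Carrier n) → (∀ i → f i ≈ g i) → sum f ≈ sum g
  sum-cong f g = sum-cong-≋ {_} {f} {g}

  sum-zero : ∀ {n} (f : Vector Carrier n) → (∀ i → f i ≈ 0#) → sum f ≈ 0#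
  sum-zero {n} f f≈0 = trans (sum-cong f (replicate n 0#) f≈0) (sum-replicate-zero n)

  span-isSubmodule : ∀ {n} (e : Vector Carrier n) → IsSubmodule (Span e)
  span-isSubmodule {n} e = record
    { resp∈ = λ { x≈y (a , eq) → a , trans (sym x≈y) eq }
    ; zero∈ = replicate n (+ 0) ,
        sym (sum-zero (λ i → φ (+ 0) * e i) (λ i → trans (*-congʳ φ.0#-homo) (zeroˡ (e i))))
    ; add∈ = λ { {x} {y} (a , eq) (b , eq′) → (λ i → a i ℤ.+ b i) , (begin
        x + y
          ≈⟨ +-cong eq eq′ ⟩
        sum (λ i → φ (a i) * e i) + sum (λ i → φ (b i) * e i)
          ≈⟨ ∑-distrib-+ (λ i → φ (a i) * e i) (λ i → φ (b i) * e i) ⟨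
        sum (λ i → φ (a i) * e i + φ (b i) * e i)
          ≈⟨ sum-cong (λ i → φ (a i) * e i + φ (b i) * e i) (λ i → φ (a i ℤ.+ b i) * e i)
               (λ i → sym (trans (*-congʳ (φ.+-homo (a i) (b i))) (distribʳ (e i) (φ (a i)) (φ (b i))))) ⟩
        sum (λ i → φ (a i ℤ.+ b i) * e i) ∎) }
    ; scale∈ = λ { k {x} (a , eq) → (λ i → k ℤ.* a i) , (begin
        φ k * x
          ≈⟨ *-congˡ eq ⟩
        φ k * sum (λ i → φ (a i) * e i)
          ≈⟨ *-distribˡ-sum (φ k) (λ i → φ (a i) * e i) ⟩
        sum (λ i → φ k * (φ (a i) * e i))
          ≈⟨ sum-cong (λ i → φ k * (φ (a i) * e i)) (λ i → φ (k ℤ.* a i) * e i)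
               (λ i → sym (trans (*-congʳ (φ.*-homo k (a i))) (*-assoc (φ k) (φ (a i)) (e i)))) ⟩
        sum (λ i → φ (k ℤ.* a i) * e i) ∎) }
    }

  module _ {n} (e : Vector Carrier n) where
    open IsSubmodule (span-isSubmodule e) public using ()
      renaming (resp∈ to span-resp; add∈ to span-add; neg∈ to span-neg)

  span-elim : ∀ {p} {P : Carrier → Set p} → IsSubmodule P →
    ∀ {n} {e : Vector Carrier n} → (∀ i → P (e i)) → ∀ {z} → Span e z → P z
  span-elim P {e = e} e∈ (a , eq) =
    resp∈ (sym eq) (sum∈ (λ i → φ (a i) * e i) (λ i → scale∈ (a i) (e∈ i)))
    where open IsSubmodule P

  span-gen : ∀ {n} (e : Vector Carrier n) i → Span e (e i)
  span-gen {suc n} e zero with (z , eq) ← IsSubmodule.zero∈ (span-isSubmodule (e ∘ suc)) =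
    + 1 ∷ z , trans (sym (+-identityʳ _))
      (+-cong (trans (sym (*-identityˡ _)) (*-congʳ (sym φ.1#-homo))) eq)
  span-gen {suc n} e (suc i) with (a , eq) ← span-gen (e ∘ suc) i =
    + 0 ∷ a , trans (sym (+-identityˡ _))
      (+-cong (sym (trans (*-congʳ φ.0#-homo) (zeroˡ _))) eq)

  -- Makes `span-elim` applicable to one factor of a product while the other is held fixed.
  preimage-isSubmodule : ∀ {p} {P : Carrier → Set p} → IsSubmodule P →
    ∀ w → IsSubmodule (λ z → P (w * z))
  preimage-isSubmodule P w = record
    { resp∈ = λ x≈y → resp∈ (*-congˡ x≈y)
    ; zero∈ = resp∈ (sym (zeroʳ w)) zero∈
    ; add∈ = λ px py → resp∈ (sym (distribˡ _ _ _)) (add∈ px py)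
    ; scale∈ = λ k {x} px → resp∈
        (solve 3 (λ k w x → k :* (w :* x) := w :* (k :* x)) refl (φ k) w x) (scale∈ k px)
    }
    where open IsSubmodule P

  span-mul-elim : ∀ {p} {P : Carrier → Set p} → IsSubmodule P →
    ∀ {m n} {e : Vector Carrier m} {f : Vector Carrier n} → (∀ i j → P (e i * f j)) →
    ∀ {x y} → Span e x → Span f y → P (x * y)
  span-mul-elim {P = P} S {f = f} ef {x} {y} x∈ y∈ =
    span-elim (preimage-isSubmodule S x)
      (λ j → resp∈ (*-comm _ _)
        (span-elim (preimage-isSubmodule S (f j)) (λ i → resp∈ (*-comm _ _) (ef i j)) x∈))
      y∈
    where open IsSubmodule S

  _⊗_ : ∀ {m n} → Vector Carrier m → Vector Carrier n → Vector Carrier (m ℕ.* n)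
  _⊗_ {n = n} e f k = uncurry (λ i j → e i * f j) (remQuot n k)

  span-mul : ∀ {m n} {e : Vector Carrier m} {f : Vector Carrier n} {x y} →
    Span e x → Span f y → Span (e ⊗ f) (x * y)
  span-mul {e = e} {f} = span-mul-elim (span-isSubmodule (e ⊗ f)) (λ i j →
    span-resp (e ⊗ f)
      (reflexive (≡.cong (uncurry (λ i j → e i * f j)) (remQuot-combine i j)))
      (span-gen (e ⊗ f) (combine i j)))

  -- Integer polynomials in `x`, and Cayley-Hamilton by elimination

  module Elimination (x : Carrier) where

    powers : ∀ d → Vector Carrier d
    powers d i = x ^ toℕ i

    -- The values at x of the integer polynomials of degree less than d, and
    -- of the monic ones of degree d.
    Low Monic : ℕ → Carrier → Set _
    Low d = Span (powers d)
    Monic d z = ∃[ l ] (Low d l × z ≈ x ^ d + l)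

    low-power : ∀ {i d} → i < d → Low d (x ^ i)
    low-power {i} {d} i<d = span-resp (powers d) (^-congʳ x (toℕ-fromℕ< i<d))
      (span-gen (powers d) (fromℕ< i<d))

    low-weaken : ∀ {d e z} → d ≤ e → Low d z → Low e z
    low-weaken {e = e} d≤e = span-elim (span-isSubmodule (powers e))
      (λ i → low-power (ℕ.<-≤-trans (toℕ<n i) d≤e))

    low-* : ∀ {d e y z} → Low d y → Low e z → Low (d ℕ.+ e) (y * z)
    low-* {d} {e} = span-mul-elim (span-isSubmodule (powers (d ℕ.+ e))) (λ i j →
      span-resp (powers (d ℕ.+ e)) (^-homo-* x (toℕ i) (toℕ j))
        (low-power (ℕ.+-mono-< (toℕ<n i) (toℕ<n j))))

    low-power-* : ∀ d {e z} → Low e z → Low (d ℕ.+ e) (x ^ d * z)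
    low-power-* d {e} = span-elim (preimage-isSubmodule (span-isSubmodule (powers (d ℕ.+ e))) (x ^ d))
      (λ i → span-resp (powers (d ℕ.+ e)) (^-homo-* x d (toℕ i))
        (low-power (ℕ.+-monoʳ-< d (toℕ<n i))))

    -- The leading power is shifted separately by `low-power-*`: treating `y` as `Low (suc d)` would
    -- lose one degree, and products of monics would no longer be seen to be monic.
    monic-*-low : ∀ {d e y z} → Monic d y → Low e z → Low (d ℕ.+ e) (y * z)
    monic-*-low {d} {e} (l , l∈ , eq) z∈ = span-resp (powers (d ℕ.+ e))
      (sym (trans (*-congʳ eq) (distribʳ _ _ _)))
      (span-add (powers (d ℕ.+ e)) (low-power-* d z∈) (low-* l∈ z∈))

    monic-* : ∀ {d e y z} → Monic d y → Monic e z → Monic (d ℕ.+ e) (y * z)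
    monic-* {d} {e} {y} {z} y∈@(l , l∈ , eq) (l′ , l′∈ , eq′) = x ^ e * l + y * l′ ,
      span-add (powers (d ℕ.+ e)) (low-weaken (ℕ.≤-reflexive (ℕ.+-comm e d)) (low-power-* e l∈))
        (monic-*-low y∈ l′∈) ,
      (begin
        y * z                                 ≈⟨ *-congˡ eq′ ⟩
        y * (x ^ e + l′)                      ≈⟨ distribˡ _ _ _ ⟩
        y * x ^ e + y * l′                    ≈⟨ +-congʳ (*-congʳ eq) ⟩
        (x ^ d + l) * x ^ e + y * l′          ≈⟨ solve 4 (λ a l b t → (a :+ l) :* b :+ t := a :* b :+ (b :* l :+ t)) refl (x ^ d) l (x ^ e) (y * l′) ⟩
        x ^ d * x ^ e + (x ^ e * l + y * l′)  ≈⟨ +-congʳ (^-homo-* x d e) ⟨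
        x ^ (d ℕ.+ e) + (x ^ e * l + y * l′)  ∎)

    monic-minus-low : ∀ {d y z} → Monic d y → Low d z → Monic d (y - z)
    monic-minus-low {d} (l , l∈ , eq) z∈ = l - _ ,
      span-add (powers d) l∈ (span-neg (powers d) z∈) , trans (+-congʳ eq) (+-assoc _ _ _)

    sum-linear : ∀ {n} a b (f g e : Vector Carrier n) →
      sum (λ j → (a * f j + b * g j) * e j) ≈
      a * sum (λ j → f j * e j) + b * sum (λ j → g j * e j)
    sum-linear a b f g e = begin
      sum (λ j → (a * f j + b * g j) * e j)
        ≈⟨ sum-cong (λ j → (a * f j + b * g j) * e j) (λ j → a * (f j * e j) + b * (g j * e j)) (λ j → solve 5 (λ a b f g e → (a :* f :+ b :* g) :* e := a :* (f :* e) :+ b :* (g :* e)) refl a b (f j) (g j) (e j)) ⟩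
      sum (λ j → a * (f j * e j) + b * (g j * e j))
        ≈⟨ ∑-distrib-+ (λ j → a * (f j * e j)) (λ j → b * (g j * e j)) ⟩
      sum (λ j → a * (f j * e j)) + sum (λ j → b * (g j * e j))
        ≈⟨ +-cong (*-distribˡ-sum a (λ j → f j * e j)) (*-distribˡ-sum b (λ j → g j * e j)) ⟨
      a * sum (λ j → f j * e j) + b * sum (λ j → g j * e j) ∎

    -- Eliminating e₀ from the system multiplies the common monic left-hand
    -- side p by p - l₀₀, which replaces determinants in the Cayley-Hamilton
    -- theorem.
    eliminate : ∀ p l₀ l e₀ e s₀ s → p * e₀ ≈ l₀ * e₀ + s₀ → p * e ≈ l * e₀ + s →
      (p - l₀) * p * e ≈ l * s₀ + (p - l₀) * s
    eliminate p l₀ l e₀ e s₀ s eq₀ eq = begin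
      (p - l₀) * p * e
        ≈⟨ *-assoc (p - l₀) p e ⟩
      (p - l₀) * (p * e)
        ≈⟨ *-congˡ eq ⟩
      (p - l₀) * (l * e₀ + s)
        ≈⟨ solve 5 (λ p l₀ l e₀ s → (p :- l₀) :* (l :* e₀ :+ s) := l :* (p :* e₀) :- l :* l₀ :* e₀ :+ (p :- l₀) :* s) refl p l₀ l e₀ s ⟩
      l * (p * e₀) - l * l₀ * e₀ + (p - l₀) * s
        ≈⟨ +-congʳ (+-congʳ (*-congˡ eq₀)) ⟩
      l * (l₀ * e₀ + s₀) - l * l₀ * e₀ + (p - l₀) * s
        ≈⟨ solve 5 (λ l l₀ e₀ s₀ t → l :* (l₀ :* e₀ :+ s₀) :- l :* l₀ :* e₀ :+ t := l :* s₀ :+ t) refl l l₀ e₀ s₀ ((p - l₀) * s) ⟩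
      l * s₀ + (p - l₀) * s ∎

    -- The hypothesis says that `(p - l₀) * e₀` is `s₀`, so whatever kills `s₀` kills `e₀` after a
    -- further factor `p - l₀`.
    annihilate-head : ∀ p q l₀ e₀ s₀ → p * e₀ ≈ l₀ * e₀ + s₀ → q * s₀ ≈ 0# →
      (p - l₀) * q * e₀ ≈ 0#
    annihilate-head p q l₀ e₀ s₀ eq₀ qs₀≈0 = begin
      (p - l₀) * q * e₀
        ≈⟨ solve 4 (λ p l q e → (p :- l) :* q :* e := q :* (p :* e) :- q :* l :* e) refl p l₀ q e₀ ⟩
      q * (p * e₀) - q * l₀ * e₀
        ≈⟨ +-congʳ (*-congˡ eq₀) ⟩
      q * (l₀ * e₀ + s₀) - q * l₀ * e₀
        ≈⟨ solve 4 (λ q l e s → q :* (l :* e :+ s) :- q :* l :* e := q :* s) refl q l₀ e₀ s₀ ⟩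
      q * s₀
        ≈⟨ qs₀≈0 ⟩
      0# ∎

    -- Induction on the number of unknowns. The invariant is that the common left-hand factor is
    -- monic of a degree above that of every entry. Pivoting on the first row preserves it: the
    -- factor becomes `(p - l₀) * p`, monic of degree `d + d`, and the new entries stay below that
    -- degree. No pivot is ever divided by, so any commutative ring will do.
    monic-annihilator : ∀ n {d p} (e : Vector Carrier n) (L : Fin n → Fin n → Carrier) →
      Monic d p → (∀ i j → Low d (L i j)) →
      (∀ i → p * e i ≈ sum (λ j → L i j * e j)) →
      ∃[ D ] ∃[ q ] (Monic D q × (∀ i → q * e i ≈ 0#))
    monic-annihilator zero e L p∈ L∈ eqs =
      0 , 1# , (0# , IsSubmodule.zero∈ (span-isSubmodule (powers 0)) , sym (+-identityʳ 1#)) , λ ()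
    monic-annihilator (suc n) {d} {p} e L p∈ L∈ eqs =
      extend (monic-annihilator n (e ∘ suc) L′ (monic-* p-l∈ p∈) L′∈ eqs′)
      where
      l₀ = L zero zero

      L′ : Fin n → Fin n → Carrier
      L′ i j = L (suc i) zero * L zero (suc j) + (p - l₀) * L (suc i) (suc j)

      p-l∈ : Monic d (p - l₀)
      p-l∈ = monic-minus-low p∈ (L∈ zero zero)

      L′∈ : ∀ i j → Low (d ℕ.+ d) (L′ i j)
      L′∈ i j = span-add (powers (d ℕ.+ d))
        (low-* (L∈ (suc i) zero) (L∈ zero (suc j))) (monic-*-low p-l∈ (L∈ (suc i) (suc j)))

      row : Fin (suc n) → Carrier
      row i = sum (λ j → L i (suc j) * e (suc j))

      eqs′ : ∀ i → (p - l₀) * p * e (suc i) ≈ sum (λ j → L′ i j * e (suc j))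
      eqs′ i = trans
        (eliminate p l₀ (L (suc i) zero) (e zero) (e (suc i)) (row zero) (row (suc i))
          (eqs zero) (eqs (suc i)))
        (sym (sum-linear (L (suc i) zero) (p - l₀)
          (λ j → L zero (suc j)) (λ j → L (suc i) (suc j)) (e ∘ suc)))

      extend : ∃[ D ] ∃[ q ] (Monic D q × (∀ i → q * e (suc i) ≈ 0#)) →
               ∃[ D ] ∃[ q ] (Monic D q × (∀ i → q * e i ≈ 0#))
      extend (D , q , q∈ , q-kills) = d ℕ.+ D , (p - l₀) * q , monic-* p-l∈ q∈ , kills
        where
        kills-row : q * row zero ≈ 0#
        kills-row = trans (*-distribˡ-sum q (λ j → L zero (suc j) * e (suc j)))
          (sum-zero (λ j → q * (L zero (suc j) * e (suc j))) λ j → trans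
            (solve 3 (λ q l e → q :* (l :* e) := l :* (q :* e)) refl q (L zero (suc j)) (e (suc j)))
            (trans (*-congˡ (q-kills j)) (zeroʳ (L zero (suc j)))))

        kills : ∀ i → (p - l₀) * q * e i ≈ 0#
        kills zero = annihilate-head p q l₀ (e zero) (row zero) (eqs zero) kills-row
        kills (suc i) = trans (*-assoc (p - l₀) q (e (suc i)))
          (trans (*-congˡ (q-kills i)) (zeroʳ (p - l₀)))

  -- The ring of integral elements

  Integral : Carrier → Set ℓ
  Integral x = Σ[ d ∈ ℕ ] Σ[ a ∈ Vector ℤ d ] x ^ d + sum (λ i → φ (a i) * x ^ toℕ i) ≈ 0#

  monic⇒integral : ∀ {x d z} → Elimination.Monic x d z → z ≈ 0# → Integral x
  monic⇒integral {d = d} (l , (a , l≈) , z≈) z≈0 =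
    d , a , trans (+-congˡ (sym l≈)) (trans (sym z≈) z≈0)

  zero-isSubmodule : IsSubmodule (_≈ 0#)
  zero-isSubmodule = record
    { resp∈ = λ x≈y → trans (sym x≈y)
    ; zero∈ = refl
    ; add∈ = λ x≈0 y≈0 → trans (+-cong x≈0 y≈0) (+-identityˡ 0#)
    ; scale∈ = λ k x≈0 → trans (*-congˡ x≈0) (zeroʳ (φ k))
    }

  -- Multiplication by `x` acts on the generators through an integer matrix. The elimination starts
  -- with `p = x`, monic of degree 1, and integers as entries of degree below 1. The resulting monic
  -- `q` kills every generator, hence `1#`, so `q ≈ 0#` is an integral equation of `x`.
  stable⇒integral : ∀ {n} {e : Vector Carrier n} {x} → Span e 1# →
    (∀ i → Span e (x * e i)) → Integral x
  stable⇒integral {n} {e} {x} 1∈ x∈ = monic⇒integral q∈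
    (trans (sym (*-identityʳ q)) (span-elim (preimage-isSubmodule zero-isSubmodule q) q-kills 1∈))
    where
    open Elimination x
    annihilator : ∃[ D ] ∃[ q ] (Monic D q × (∀ i → q * e i ≈ 0#))
    annihilator = monic-annihilator n {1} {x} e (λ i j → φ (proj₁ (x∈ i) j))
      (0# , IsSubmodule.zero∈ (span-isSubmodule (powers 1)) ,
       sym (trans (+-identityʳ _) (*-identityʳ x)))
      (λ i j → span-resp (powers 1) (*-identityʳ _)
        (IsSubmodule.scale∈ (span-isSubmodule (powers 1)) (proj₁ (x∈ i) j)
          (low-power {0} (ℕ.s≤s ℕ.z≤n))))
      (λ i → proj₂ (x∈ i))
    q = proj₁ (proj₂ annihilator)
    q∈ = proj₁ (proj₂ (proj₂ annihilator))
    q-kills = proj₂ (proj₂ (proj₂ annihilator))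

  integral-resp : ∀ {x y} → x ≈ y → Integral x → Integral y
  integral-resp {x} {y} x≈y (d , a , eq) = d , a , trans
    (+-cong (^-congˡ d (sym x≈y))
      (sum-cong (λ i → φ (a i) * y ^ toℕ i) (λ i → φ (a i) * x ^ toℕ i)
        (λ i → *-congˡ (^-congˡ (toℕ i) (sym x≈y)))))
    eq

  integral-φ : ∀ k → Integral (φ k)
  integral-φ k = 1 , (λ _ → ℤ.- k) , (begin
    φ k * 1# + (φ (ℤ.- k) * 1# + 0#)  ≈⟨ +-congˡ (+-identityʳ (φ (ℤ.- k) * 1#)) ⟩
    φ k * 1# + φ (ℤ.- k) * 1#         ≈⟨ +-congˡ (*-congʳ (φ.-‿homo k)) ⟩
    φ k * 1# + (- φ k) * 1#           ≈⟨ solve 1 (λ k → k :* :1 :+ (:- k) :* :1 := con (+ 0)) refl (φ k) ⟩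
    φ (+ 0)                           ≈⟨ φ.0#-homo ⟩
    0#                                ∎)

  integral-quadratic : ∀ {x} k → x * x ≈ x + φ k → Integral x
  integral-quadratic {x} k eq = 2 , ℤ.- k ∷ (λ _ → ℤ.- (+ 1)) , (begin
    x ^ 2 + (φ (ℤ.- k) * 1# + (φ (ℤ.- (+ 1)) * x ^ 1 + 0#))
      ≈⟨ +-congˡ (+-cong (*-congʳ (φ.-‿homo k)) (+-identityʳ (φ (ℤ.- (+ 1)) * x ^ 1))) ⟩
    x ^ 2 + ((- φ k) * 1# + φ (ℤ.- (+ 1)) * x ^ 1)
      ≈⟨ solve 2 (λ x k → x :^ 2 :+ ((:- k) :* :1 :+ con (ℤ.- (+ 1)) :* x :^ 1) := x :* x :- (x :+ k)) refl x (φ k) ⟩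
    x * x - (x + φ k)
      ≈⟨ +-congʳ eq ⟩
    (x + φ k) - (x + φ k)
      ≈⟨ -‿inverseʳ (x + φ k) ⟩
    0# ∎)

  module _ {x} (x∈ : Integral x) where
    open Elimination x

    private
      d = proj₁ x∈
      a = proj₁ (proj₂ x∈)

    top-power-low : Low d (x ^ d)
    top-power-low = span-resp (powers d) (begin
      - sum (λ i → φ (a i) * x ^ toℕ i)
        ≈⟨ solve 2 (λ t s → :- s := t :- (t :+ s)) refl (x ^ d) (sum (λ i → φ (a i) * x ^ toℕ i)) ⟩
      x ^ d - (x ^ d + sum (λ i → φ (a i) * x ^ toℕ i))
        ≈⟨ +-congˡ (-‿cong (proj₂ (proj₂ x∈))) ⟩
      x ^ d - 0#
        ≈⟨ +-congˡ (trans (sym (+-identityˡ (- 0#))) (-‿inverseʳ 0#)) ⟩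
      x ^ d + 0#
        ≈⟨ +-identityʳ (x ^ d) ⟩
      x ^ d ∎) (span-neg (powers d) (a , refl))

    -- The bound includes `d` for two reasons: it covers `x * x ^ i` for `i < d`, and it covers
    -- `x ^ 0` even when `d` is zero and the equation says that 1 is 0.
    power-low : ∀ {i} → i ≤ d → Low d (x ^ i)
    power-low i≤d with ℕ.m≤n⇒m<n∨m≡n i≤d
    ... | inj₁ i<d = low-power i<d
    ... | inj₂ ≡.refl = top-power-low

    powers-stable : ∀ (i : Fin d) → Low d (x * x ^ toℕ i)
    powers-stable i = power-low (toℕ<n i)

  module _ {x y} (x∈ : Integral x) (y∈ : Integral y) where

    private
      xs = Elimination.powers x (proj₁ x∈)
      ys = Elimination.powers y (proj₁ y∈)

      1∈xs⊗ys : Span (xs ⊗ ys) 1#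
      1∈xs⊗ys = span-resp (xs ⊗ ys) (*-identityˡ 1#)
        (span-mul {e = xs} {ys} (power-low x∈ ℕ.z≤n) (power-low y∈ ℕ.z≤n))

      module _ (k : Fin (proj₁ x∈ ℕ.* proj₁ y∈)) where
        i = proj₁ (remQuot {proj₁ x∈} (proj₁ y∈) k)
        j = proj₂ (remQuot {proj₁ x∈} (proj₁ y∈) k)

    -- The products of a power of `x` and a power of `y`, below the two degrees, span a module that
    -- contains `1#` and is stable under both `x` and `y`.
    integral-+ : Integral (x + y)
    integral-+ = stable⇒integral {e = xs ⊗ ys} 1∈xs⊗ys λ k →
      span-resp (xs ⊗ ys)
        (solve 4 (λ x y u v → x :* u :* v :+ u :* (y :* v) := (x :+ y) :* (u :* v)) refl x y (xs (i k)) (ys (j k)))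
        (span-add (xs ⊗ ys)
          (span-mul {e = xs} {ys} (powers-stable x∈ (i k)) (span-gen ys (j k)))
          (span-mul {e = xs} {ys} (span-gen xs (i k)) (powers-stable y∈ (j k))))

    integral-* : Integral (x * y)
    integral-* = stable⇒integral {e = xs ⊗ ys} 1∈xs⊗ys λ k →
      span-resp (xs ⊗ ys)
        (solve 4 (λ x y u v → x :* u :* (y :* v) := x :* y :* (u :* v)) refl x y (xs (i k)) (ys (j k)))
        (span-mul {e = xs} {ys} (powers-stable x∈ (i k)) (powers-stable y∈ (j k)))

  integral-neg : ∀ {x} → Integral x → Integral (- x)
  integral-neg {x} x∈ = integral-resp
    (solve 1 (λ x → con (ℤ.- (+ 1)) :* x := :- x) refl x) (integral-* (integral-φ (ℤ.- (+ 1))) x∈)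

  integral-- : ∀ {x y} → Integral x → Integral y → Integral (x - y)
  integral-- x∈ y∈ = integral-+ x∈ (integral-neg y∈)

  integral-1 : Integral 1#
  integral-1 = integral-resp φ.1#-homo (integral-φ (+ 1))

  integral-0 : Integral 0#
  integral-0 = integral-resp φ.0#-homo (integral-φ (+ 0))

  -- The order generated by two quadratic elements, and its reduction modulo 2

  data ℤ[_,_] (u v : Carrier) : Carrier → Set (c ⊔ ℓ) where
    one   : ℤ[ u , v ] 1#
    left  : ℤ[ u , v ] u
    right : ℤ[ u , v ] v
    add   : ∀ {x y} → ℤ[ u , v ] x → ℤ[ u , v ] y → ℤ[ u , v ] (x + y)
    neg   : ∀ {x} → ℤ[ u , v ] x → ℤ[ u , v ] (- x)
    mul   : ∀ {x y} → ℤ[ u , v ] x → ℤ[ u , v ] y → ℤ[ u , v ] (x * y)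
    resp  : ∀ {x y} → x ≈ y → ℤ[ u , v ] x → ℤ[ u , v ] y

  module _ {u v : Carrier} where

    nonneg : ∀ n → ℤ[ u , v ] (φ (+ n))
    nonneg zero = resp (trans (-‿inverseʳ 1#) (sym φ.0#-homo)) (add one (neg one))
    nonneg (suc n) =
      resp (sym (trans (φ.+-homo (+ 1) (+ n)) (+-congʳ φ.1#-homo))) (add one (nonneg n))

    int : ∀ k → ℤ[ u , v ] (φ k)
    int (+ n) = nonneg n
    int -[1+ n ] = resp (sym (φ.-‿homo (+ suc n))) (neg (nonneg (suc n)))

    power : ∀ {x} n → ℤ[ u , v ] x → ℤ[ u , v ] (x ^ n)
    power zero x∈ = one
    power (suc n) x∈ = mul x∈ (power n x∈)

    -- Divisibility by 2 inside the order: the quotient must be a member too, and it is this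
    -- quotient that `half-closed` extracts.
    Even : Carrier → Set (c ⊔ ℓ)
    Even x = ∃[ z ] (ℤ[ u , v ] z × x ≈ φ (+ 2) * z)

    even-*ˡ : ∀ {x y} → ℤ[ u , v ] x → Even y → Even (x * y)
    even-*ˡ {x} x∈ (z , z∈ , eq) = x * z , mul x∈ z∈ ,
      trans (*-congˡ eq) (solve 2 (λ x z → x :* (con (+ 2) :* z) := con (+ 2) :* (x :* z)) refl x z)

    even-isSubmodule : IsSubmodule Even
    even-isSubmodule = record
      { resp∈ = λ { x≈y (z , z∈ , eq) → z , z∈ , trans (sym x≈y) eq }
      ; zero∈ = 0# , resp φ.0#-homo (int (+ 0)) , sym (zeroʳ (φ (+ 2)))
      ; add∈ = λ { (z , z∈ , eq) (z′ , z′∈ , eq′) →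
          z + z′ , add z∈ z′∈ , trans (+-cong eq eq′) (sym (distribˡ (φ (+ 2)) z z′)) }
      ; scale∈ = λ k → even-*ˡ (int k)
      }

  module QuadraticOrder {u v : Carrier} {k l : ℤ}
    (u-eq : u * u ≈ u + φ k) (v-eq : v * v ≈ v + φ l) where

    order⇒integral : ∀ {x} → ℤ[ u , v ] x → Integral x
    order⇒integral one = integral-1
    order⇒integral left = integral-quadratic k u-eq
    order⇒integral right = integral-quadratic l v-eq
    order⇒integral (add x∈ y∈) = integral-+ (order⇒integral x∈) (order⇒integral y∈)
    order⇒integral (neg x∈) = integral-neg (order⇒integral x∈)
    order⇒integral (mul x∈ y∈) = integral-* (order⇒integral x∈) (order⇒integral y∈)
    order⇒integral (resp x≈y x∈) = integral-resp x≈y (order⇒integral x∈)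

    -- Fourth powers, because the residue fields of ℤ[ u , v ] at 2 embed in 𝔽₄.
    Frobenius : Carrier → Set (c ⊔ ℓ)
    Frobenius x = ∃[ z ] (ℤ[ u , v ] z × x ^ 4 ≈ x + φ (+ 2) * z)

    -- Fermat's congruence for the prime 2, with the quotient recorded as a member of the order.
    IdempotentMod2 : ℤ → Set (c ⊔ ℓ)
    IdempotentMod2 j = ∃[ z ] (ℤ[ u , v ] z × φ j * φ j ≈ φ j + φ (+ 2) * z)

    idempotent-mod-2-nonneg : ∀ n → IdempotentMod2 (+ n)
    idempotent-mod-2-nonneg zero = φ (+ 0) , int (+ 0) ,
      trans (trans (*-congʳ φ.0#-homo) (zeroˡ (φ (+ 0)))) (sym (trans
        (+-cong φ.0#-homo (trans (*-congˡ φ.0#-homo) (zeroʳ (φ (+ 2))))) (+-identityˡ 0#)))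
    idempotent-mod-2-nonneg (suc n) =
      let z , z∈ , eq = idempotent-mod-2-nonneg n
          m = φ (+ n)
          1+m = φ.+-homo (+ 1) (+ n)
      in m + z , add (int (+ n)) z∈ , (begin
        φ (+ suc n) * φ (+ suc n)
          ≈⟨ *-cong 1+m 1+m ⟩
        (φ (+ 1) + m) * (φ (+ 1) + m)
          ≈⟨ solve 1 (λ m → (con (+ 1) :+ m) :* (con (+ 1) :+ m) := con (+ 1) :+ con (+ 2) :* m :+ m :* m) refl m ⟩
        φ (+ 1) + φ (+ 2) * m + m * m
          ≈⟨ +-congˡ eq ⟩
        φ (+ 1) + φ (+ 2) * m + (m + φ (+ 2) * z)
          ≈⟨ solve 2 (λ m z → con (+ 1) :+ con (+ 2) :* m :+ (m :+ con (+ 2) :* z) := con (+ 1) :+ m :+ con (+ 2) :* (m :+ z)) refl m z ⟩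
        φ (+ 1) + m + φ (+ 2) * (m + z)
          ≈⟨ +-congʳ 1+m ⟨
        φ (+ suc n) + φ (+ 2) * (m + z) ∎)

    idempotent-mod-2 : ∀ j → IdempotentMod2 j
    idempotent-mod-2 (+ n) = idempotent-mod-2-nonneg n
    idempotent-mod-2 -[1+ n ] =
      let z , z∈ , eq = idempotent-mod-2-nonneg (suc n)
          m = φ (+ suc n)
          -m = φ.-‿homo (+ suc n)
      in m + z , add (int (+ suc n)) z∈ , (begin
        φ -[1+ n ] * φ -[1+ n ]
          ≈⟨ *-cong -m -m ⟩
        (- m) * (- m)
          ≈⟨ solve 1 (λ m → (:- m) :* (:- m) := m :* m) refl m ⟩
        m * m
          ≈⟨ eq ⟩
        m + φ (+ 2) * z
          ≈⟨ solve 2 (λ m z → m :+ con (+ 2) :* z := (:- m) :+ con (+ 2) :* (m :+ z)) refl m z ⟩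
        - m + φ (+ 2) * (m + z)
          ≈⟨ +-congʳ -m ⟨
        φ -[1+ n ] + φ (+ 2) * (m + z) ∎)

    -- Modulo 2, squaring sends `x` to `x + j` and fixes `j`, so squaring twice adds `2 j`.
    frobenius-quadratic : ∀ {x} j → ℤ[ u , v ] x → x * x ≈ x + φ j → Frobenius x
    frobenius-quadratic {x} j x∈ x-eq =
      let z , z∈ , eq = idempotent-mod-2 j
      in φ j + φ j * x + z , add (add (int j) (mul (int j) x∈)) z∈ , (begin
        x ^ 4
          ≈⟨ solve 1 (λ x → x :^ 4 := (x :* x) :* (x :* x)) refl x ⟩
        (x * x) * (x * x)
          ≈⟨ *-cong x-eq x-eq ⟩
        (x + φ j) * (x + φ j)
          ≈⟨ solve 2 (λ x j → (x :+ j) :* (x :+ j) := x :* x :+ con (+ 2) :* (j :* x) :+ j :* j) refl x (φ j) ⟩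
        x * x + φ (+ 2) * (φ j * x) + φ j * φ j
          ≈⟨ +-cong (+-congʳ x-eq) eq ⟩
        x + φ j + φ (+ 2) * (φ j * x) + (φ j + φ (+ 2) * z)
          ≈⟨ solve 3 (λ x j z → x :+ j :+ con (+ 2) :* (j :* x) :+ (j :+ con (+ 2) :* z) := x :+ con (+ 2) :* (j :+ j :* x :+ z)) refl x (φ j) z ⟩
        x + φ (+ 2) * (φ j + φ j * x + z) ∎)

    frobenius : ∀ {x} → ℤ[ u , v ] x → Frobenius x
    frobenius one = 0# , resp φ.0#-homo (int (+ 0)) , trans
      (solve 0 (:1 :^ 4 := :1) refl)
      (sym (trans (+-congˡ (zeroʳ (φ (+ 2)))) (+-identityʳ 1#)))
    frobenius left = frobenius-quadratic k left u-eq
    frobenius right = frobenius-quadratic l right v-eq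
    frobenius (add {x} {y} x∈ y∈) =
      let z , z∈ , eq = frobenius x∈
          z′ , z′∈ , eq′ = frobenius y∈
          -- Half of the mixed terms `4 x³y + 6 x²y² + 4 xy³` of the fourth power.
          w = x * y * (φ (+ 2) * (x * x) + φ (+ 3) * (x * y) + φ (+ 2) * (y * y))
      in z + z′ + w ,
        add (add z∈ z′∈) (mul (mul x∈ y∈)
          (add (add (mul (int (+ 2)) (mul x∈ x∈)) (mul (int (+ 3)) (mul x∈ y∈)))
            (mul (int (+ 2)) (mul y∈ y∈)))) , (begin
        (x + y) ^ 4
          ≈⟨ solve 2 (λ x y → (x :+ y) :^ 4 := x :^ 4 :+ y :^ 4 :+ con (+ 2) :* (x :* y :* (con (+ 2) :* (x :* x) :+ con (+ 3) :* (x :* y) :+ con (+ 2) :* (y :* y)))) refl x y ⟩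
        x ^ 4 + y ^ 4 + φ (+ 2) * w
          ≈⟨ +-congʳ (+-cong eq eq′) ⟩
        x + φ (+ 2) * z + (y + φ (+ 2) * z′) + φ (+ 2) * w
          ≈⟨ solve 5 (λ x y z z′ w → x :+ con (+ 2) :* z :+ (y :+ con (+ 2) :* z′) :+ con (+ 2) :* w := x :+ y :+ con (+ 2) :* (z :+ z′ :+ w)) refl x y z z′ w ⟩
        x + y + φ (+ 2) * (z + z′ + w) ∎)
    frobenius (neg {x} x∈) =
      let z , z∈ , eq = frobenius x∈
      in x + z , add x∈ z∈ , (begin
        (- x) ^ 4
          ≈⟨ solve 1 (λ x → (:- x) :^ 4 := x :^ 4) refl x ⟩
        x ^ 4
          ≈⟨ eq ⟩
        x + φ (+ 2) * z
          ≈⟨ solve 2 (λ x z → x :+ con (+ 2) :* z := (:- x) :+ con (+ 2) :* (x :+ z)) refl x z ⟩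
        - x + φ (+ 2) * (x + z) ∎)
    frobenius (mul {x} {y} x∈ y∈) =
      let z , z∈ , eq = frobenius x∈
          z′ , z′∈ , eq′ = frobenius y∈
      in x * z′ + z * y + φ (+ 2) * (z * z′) ,
        add (add (mul x∈ z′∈) (mul z∈ y∈)) (mul (int (+ 2)) (mul z∈ z′∈)) , (begin
        (x * y) ^ 4
          ≈⟨ ^-distrib-* x y 4 ⟩
        x ^ 4 * y ^ 4
          ≈⟨ *-cong eq eq′ ⟩
        (x + φ (+ 2) * z) * (y + φ (+ 2) * z′)
          ≈⟨ solve 4 (λ x y z z′ → (x :+ con (+ 2) :* z) :* (y :+ con (+ 2) :* z′) := x :* y :+ con (+ 2) :* (x :* z′ :+ z :* y :+ con (+ 2) :* (z :* z′))) refl x y z z′ ⟩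
        x * y + φ (+ 2) * (x * z′ + z * y + φ (+ 2) * (z * z′)) ∎)
    frobenius (resp x≈y x∈) =
      let z , z∈ , eq = frobenius x∈
      in z , z∈ , trans (^-congˡ 4 (sym x≈y)) (trans eq (+-congʳ x≈y))

    -- The order is reduced modulo 2. By `y⁴ ≡ y`, multiplying `y ^ (n + 2)` by `y²` gives
    -- `y ^ (n + 1)` modulo 2, so the exponent of an even power can be lowered by one until it is 1.
    even-root : ∀ n {y} → ℤ[ u , v ] y → Even {u} {v} (y ^ n) → Even {u} {v} y
    even-root zero {y} y∈ 1-even =
      IsSubmodule.resp∈ even-isSubmodule (*-identityʳ y) (even-*ˡ y∈ 1-even)
    even-root (suc zero) {y} y∈ y-even =
      IsSubmodule.resp∈ even-isSubmodule (*-identityʳ y) y-even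
    even-root (suc (suc n)) {y} y∈ yⁿ-even =
      let z , z∈ , eq = frobenius y∈
      in even-root (suc n) y∈ (IsSubmodule.resp∈ even-isSubmodule (begin
        (y * y) * y ^ suc (suc n) - φ (+ 2) * (z * y ^ n)
          ≈⟨ solve 3 (λ y z p → (y :* y) :* (y :* (y :* p)) :- con (+ 2) :* (z :* p) := (y :^ 4 :- con (+ 2) :* z) :* p) refl y z (y ^ n) ⟩
        (y ^ 4 - φ (+ 2) * z) * y ^ n
          ≈⟨ *-congʳ (+-congʳ eq) ⟩
        (y + φ (+ 2) * z - φ (+ 2) * z) * y ^ n
          ≈⟨ solve 3 (λ y z p → (y :+ z :- z) :* p := y :* p) refl y (φ (+ 2) * z) (y ^ n) ⟩
        y ^ suc n ∎)
        (IsSubmodule.add∈ even-isSubmodule (even-*ˡ (mul y∈ y∈) yⁿ-even)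
          (IsSubmodule.neg∈ even-isSubmodule (z * y ^ n , mul z∈ (power n y∈) , refl))))

    -- Of the `d` factors 2 in front of `w ^ j`, `j` are spent on turning `w` into `y`; as `j < d`,
    -- at least one is left over.
    low-even : ∀ {y w} → ℤ[ u , v ] y → y ≈ φ (+ 2) * w →
      ∀ {d t} → Elimination.Low w d t → Even {u} {v} (φ (+ 2) ^ d * t)
    low-even {y} {w} y∈ y≈2w {d} =
      span-elim (preimage-isSubmodule even-isSubmodule (φ (+ 2) ^ d)) λ i →
        let j = toℕ i
            h = d ℕ.∸ suc j
        in φ (+ 2) ^ h * y ^ j , mul (power h (int (+ 2))) (power j y∈) , (begin
          φ (+ 2) ^ d * w ^ j
            ≈⟨ *-congʳ (^-congʳ (φ (+ 2)) (≡.sym (ℕ.m+[n∸m]≡n (toℕ<n i)))) ⟩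
          φ (+ 2) ^ (suc j ℕ.+ h) * w ^ j
            ≈⟨ *-congʳ (^-homo-* (φ (+ 2)) (suc j) h) ⟩
          φ (+ 2) * φ (+ 2) ^ j * φ (+ 2) ^ h * w ^ j
            ≈⟨ solve 3 (λ p q r → con (+ 2) :* p :* q :* r := con (+ 2) :* (q :* (p :* r))) refl (φ (+ 2) ^ j) (φ (+ 2) ^ h) (w ^ j) ⟩
          φ (+ 2) * (φ (+ 2) ^ h * (φ (+ 2) ^ j * w ^ j))
            ≈⟨ *-congˡ (*-congˡ (^-distrib-* (φ (+ 2)) w j)) ⟨
          φ (+ 2) * (φ (+ 2) ^ h * (φ (+ 2) * w) ^ j)
            ≈⟨ *-congˡ (*-congˡ (^-congˡ j y≈2w)) ⟨
          φ (+ 2) * (φ (+ 2) ^ h * y ^ j) ∎)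

    module _ (2-cancel : ∀ {x y} → φ (+ 2) * x ≈ φ (+ 2) * y → x ≈ y) where

      -- This is maximality of the order at 2, usually read off from an odd discriminant; here it
      -- rests on the order being reduced modulo 2.
      half-closed : ∀ {w} → Integral w → ℤ[ u , v ] (φ (+ 2) * w) → ℤ[ u , v ] w
      half-closed {w} w∈ 2w∈ =
        let d = proj₁ w∈
            z , z∈ , eq = even-root d 2w∈ (IsSubmodule.resp∈ even-isSubmodule
              (sym (^-distrib-* (φ (+ 2)) w d)) (low-even 2w∈ refl (top-power-low w∈)))
        in resp (sym (2-cancel eq)) z∈

      -- The multiplier is `suc n`, so it is odd when `n` is even. For `n = 2 e + 1` it is
      -- `2 (e + 1)`, and `half-closed` applied to `(e + 1) x` removes the factor 2.
      odd-multiple : ∀ n → Acc _<_ n → ∀ {x} → Integral x → ℤ[ u , v ] (φ (+ suc n) * x) →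
        ∃[ e ] ℤ[ u , v ] (φ (+ suc (e ℕ.+ e)) * x)
      odd-multiple n (acc rec) {x} x∈ nx∈ with parity n
      ... | e , inj₁ ≡.refl = e , nx∈
      ... | e , inj₂ ≡.refl = odd-multiple e (rec (ℕ.s≤s (ℕ.m≤m+n e e))) x∈
        (half-closed (integral-* (integral-φ (+ suc e)) x∈) (resp (begin
          φ (+ suc (suc (e ℕ.+ e))) * x
            ≈⟨ *-congʳ (reflexive (≡.cong φ (≡.cong (+_) (≡.cong suc (≡.sym (ℕ.+-suc e e)))))) ⟩
          φ (+ suc e ℤ.+ + suc e) * x
            ≈⟨ *-congʳ (φ.+-homo (+ suc e) (+ suc e)) ⟩
          (φ (+ suc e) + φ (+ suc e)) * x
            ≈⟨ solve 2 (λ n x → (n :+ n) :* x := con (+ 2) :* (n :* x)) refl (φ (+ suc e)) x ⟩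
          φ (+ 2) * (φ (+ suc e) * x) ∎) nx∈))

      square-mod-2 : ∀ n {x} → Integral x → ℤ[ u , v ] (φ (+ suc n) * x) →
        ∃[ z ] (Integral z × x ≈ (x * x) * (x * x) + φ (+ 2) * z)
      square-mod-2 n {x} x∈ nx∈ =
        let e , ex∈ = odd-multiple n (<-wellFounded n) x∈ nx∈
            f = φ (+ e)
            z , z∈ , eq = frobenius ex∈
            -- With `D = 1 + 2 f` this is the `g` in `D⁴ = 1 + 2 g`. Then `D⁴ x⁴ = D x + 2 z`
            -- rearranges to `x = x⁴ + 2 (g x⁴ - f x - z)`.
            g = φ (+ 4) * f + φ (+ 12) * f ^ 2 + φ (+ 16) * f ^ 3 + φ (+ 8) * f ^ 4
            D≈ = trans (φ.+-homo (+ 1) (+ (e ℕ.+ e))) (+-congˡ (φ.+-homo (+ e) (+ e)))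
        in g * ((x * x) * (x * x)) - f * x - z ,
          integral-- (integral-- (integral-* (order⇒integral (add (add (add
            (mul (int (+ 4)) (int (+ e))) (mul (int (+ 12)) (power 2 (int (+ e)))))
            (mul (int (+ 16)) (power 3 (int (+ e))))) (mul (int (+ 8)) (power 4 (int (+ e))))))
            (integral-* (integral-* x∈ x∈) (integral-* x∈ x∈)))
            (integral-* (integral-φ (+ e)) x∈)) (order⇒integral z∈) , (begin
          x
            ≈⟨ solve 3 (λ x f z → x := (con (+ 1) :+ (f :+ f)) :* x :+ con (+ 2) :* z :- con (+ 2) :* (f :* x :+ z)) refl x f z ⟩
          (φ (+ 1) + (f + f)) * x + φ (+ 2) * z - φ (+ 2) * (f * x + z)
            ≈⟨ +-congʳ (+-congʳ (*-congʳ D≈)) ⟨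
          φ (+ suc (e ℕ.+ e)) * x + φ (+ 2) * z - φ (+ 2) * (f * x + z)
            ≈⟨ +-congʳ eq ⟨
          (φ (+ suc (e ℕ.+ e)) * x) ^ 4 - φ (+ 2) * (f * x + z)
            ≈⟨ +-congʳ (^-congˡ 4 (*-congʳ D≈)) ⟩
          ((φ (+ 1) + (f + f)) * x) ^ 4 - φ (+ 2) * (f * x + z)
            ≈⟨ solve 3 (λ x f z → ((con (+ 1) :+ (f :+ f)) :* x) :^ 4 :- con (+ 2) :* (f :* x :+ z) :=
                 (x :* x) :* (x :* x) :+ con (+ 2) :* ((con (+ 4) :* f :+ con (+ 12) :* f :^ 2 :+ con (+ 16) :* f :^ 3 :+ con (+ 8) :* f :^ 4) :* ((x :* x) :* (x :* x)) :- f :* x :- z)) refl x f z ⟩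
          (x * x) * (x * x) + φ (+ 2) * (g * ((x * x) * (x * x)) - f * x - z) ∎)

  -- Sums of squares from an isotropic vector

  SumOfSquares : ℕ → Carrier → Set (c ⊔ ℓ)
  SumOfSquares k x = Σ[ y ∈ Vector Carrier k ] ((∀ i → Integral (y i)) × x ≈ sum (λ i → y i * y i))

  sum-integral : ∀ {n} (a : Vector Carrier n) → (∀ i → Integral (a i)) → Integral (sum a)
  sum-integral {zero} a a∈ = integral-0
  sum-integral {suc n} a a∈ = integral-+ (a∈ zero) (sum-integral (a ∘ suc) (a∈ ∘ suc))

  -- The witness is the second elementary symmetric polynomial of the entries.
  square-of-sum : ∀ {n} (a : Vector Carrier n) → (∀ i → Integral (a i)) →
    ∃[ z ] (Integral z × sum a * sum a ≈ sum (λ i → a i * a i) + φ (+ 2) * z)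
  square-of-sum {zero} a a∈ = 0# , integral-0 , trans (zeroˡ 0#)
    (sym (trans (+-identityˡ (φ (+ 2) * 0#)) (zeroʳ (φ (+ 2)))))
  square-of-sum {suc n} a a∈ =
    let a₀ = a zero
        S = sum (a ∘ suc)
        Q = sum (λ i → a (suc i) * a (suc i))
        z , z∈ , eq = square-of-sum (a ∘ suc) (a∈ ∘ suc)
    in a₀ * S + z , integral-+ (integral-* (a∈ zero) (sum-integral (a ∘ suc) (a∈ ∘ suc))) z∈ , (begin
      (a₀ + S) * (a₀ + S)
        ≈⟨ solve 2 (λ a S → (a :+ S) :* (a :+ S) := a :* a :+ con (+ 2) :* (a :* S) :+ S :* S) refl a₀ S ⟩
      a₀ * a₀ + φ (+ 2) * (a₀ * S) + S * S
        ≈⟨ +-congˡ eq ⟩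
      a₀ * a₀ + φ (+ 2) * (a₀ * S) + (Q + φ (+ 2) * z)
        ≈⟨ solve 4 (λ a S Q z → a :* a :+ con (+ 2) :* (a :* S) :+ (Q :+ con (+ 2) :* z) := a :* a :+ Q :+ con (+ 2) :* (a :* S :+ z)) refl a₀ S Q z ⟩
      a₀ * a₀ + Q + φ (+ 2) * (a₀ * S + z) ∎)

  sum-squares-translate : ∀ {n} u t (a : Vector Carrier n) →
    sum (λ i → (u + t * a i) * (u + t * a i)) ≈
    φ (+ n) * (u * u) + φ (+ 2) * (u * t * sum a) + t * t * sum (λ i → a i * a i)
  sum-squares-translate {zero} u t a = begin
    0#
      ≈⟨ φ.0#-homo ⟨
    φ (+ 0)
      ≈⟨ solve 2 (λ u t → con (+ 0) := con (+ 0) :* (u :* u) :+ con (+ 2) :* (u :* t :* con (+ 0)) :+ t :* t :* con (+ 0)) refl u t ⟩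
    φ (+ 0) * (u * u) + φ (+ 2) * (u * t * φ (+ 0)) + t * t * φ (+ 0)
      ≈⟨ +-cong (+-congˡ (*-congˡ (*-congˡ φ.0#-homo))) (*-congˡ φ.0#-homo) ⟩
    φ (+ 0) * (u * u) + φ (+ 2) * (u * t * 0#) + t * t * 0# ∎
  sum-squares-translate {suc n} u t a =
    let a₀ = a zero
        S = sum (a ∘ suc)
        Q = sum (λ i → a (suc i) * a (suc i))
    in begin
      (u + t * a₀) * (u + t * a₀) + sum (λ i → (u + t * a (suc i)) * (u + t * a (suc i)))
        ≈⟨ +-congˡ (sum-squares-translate u t (a ∘ suc)) ⟩
      (u + t * a₀) * (u + t * a₀) + (φ (+ n) * (u * u) + φ (+ 2) * (u * t * S) + t * t * Q)
        ≈⟨ solve 6 (λ u t a S Q n →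
             (u :+ t :* a) :* (u :+ t :* a) :+ (n :* (u :* u) :+ con (+ 2) :* (u :* t :* S) :+ t :* t :* Q) :=
             (con (+ 1) :+ n) :* (u :* u) :+ con (+ 2) :* (u :* t :* (a :+ S)) :+ t :* t :* (a :* a :+ Q))
             refl u t a₀ S Q (φ (+ n)) ⟩
      (φ (+ 1) + φ (+ n)) * (u * u) + φ (+ 2) * (u * t * (a₀ + S)) + t * t * (a₀ * a₀ + Q)
        ≈⟨ +-congʳ (+-congʳ (*-congʳ (φ.+-homo (+ 1) (+ n)))) ⟨
      φ (+ suc n) * (u * u) + φ (+ 2) * (u * t * (a₀ + S)) + t * t * (a₀ * a₀ + Q) ∎

  -- As Σ aᵢ² = -1, the vector (1 , a) is isotropic for y₀² + Σ yᵢ².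
  -- Translating a vector w that pairs to 1 with it by t (1 , a) changes the
  -- value by 2t, so it suffices to match x modulo 2.  As (Σ aᵢ)² ≡ 1 and the
  -- length of a is even, wᵢ = (Σ aᵢ) (r - 1) for i ≥ 1 gives the value r²
  -- modulo 2.
  sum-of-squares : ∀ q (a : Vector Carrier (q ℕ.* 2)) → (∀ i → Integral (a i)) →
    - 1# ≈ sum (λ i → a i * a i) →
    ∀ {x r z} → Integral r → Integral z → x ≈ r * r + φ (+ 2) * z →
    SumOfSquares (suc (q ℕ.* 2)) x
  sum-of-squares q a a∈ -1≈ {x} {r} {z} r∈ z∈ x≈ =
    (w₀ + t) ∷ (λ i → u + t * a i) ,
    (λ { zero → integral-+ (integral-- (integral-φ (+ 1)) (integral-* u∈ A∈)) t∈
       ; (suc i) → integral-+ u∈ (integral-* t∈ (a∈ i)) }) ,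
    sym (begin
      (w₀ + t) * (w₀ + t) + sum (λ i → (u + t * a i) * (u + t * a i))
        ≈⟨ +-congˡ (sum-squares-translate u t a) ⟩
      (w₀ + t) * (w₀ + t) + (φ (+ (q ℕ.* 2)) * (u * u) + φ (+ 2) * (u * t * A) + t * t * sum (λ i → a i * a i))
        ≈⟨ +-congˡ (+-cong (+-congʳ (*-congʳ 2q≈)) (*-congˡ (sym -1≈))) ⟩
      (w₀ + t) * (w₀ + t) + (h * φ (+ 2) * (u * u) + φ (+ 2) * (u * t * A) + t * t * (- 1#))
        ≈⟨ solve 4 (λ A s t n →
             (con (+ 1) :- A :* s :* A :+ t) :* (con (+ 1) :- A :* s :* A :+ t) :+ (n :+ con (+ 2) :* (A :* s :* t :* A) :+ t :* t :* (:- :1)) :=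
             (con (+ 1) :- A :* A :* s) :* (con (+ 1) :- A :* A :* s) :+ con (+ 2) :* t :+ n)
             refl A s t (h * φ (+ 2) * (u * u)) ⟩
      (φ (+ 1) - A * A * s) * (φ (+ 1) - A * A * s) + φ (+ 2) * t + h * φ (+ 2) * (u * u)
        ≈⟨ +-congʳ (+-congʳ (*-cong w₀≈ w₀≈)) ⟩
      (φ (+ 1) - (- 1# + φ (+ 2) * b) * s) * (φ (+ 1) - (- 1# + φ (+ 2) * b) * s) + φ (+ 2) * t + h * φ (+ 2) * (u * u)
        ≈⟨ solve 5 (λ r b z h U →
             (con (+ 1) :- (:- :1 :+ con (+ 2) :* b) :* (r :- con (+ 1))) :* (con (+ 1) :- (:- :1 :+ con (+ 2) :* b) :* (r :- con (+ 1)))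
             :+ con (+ 2) :* (z :- h :* U :+ con (+ 2) :* (b :* (r :- con (+ 1)) :* (r :- b :* (r :- con (+ 1))))) :+ h :* con (+ 2) :* U :=
             r :* r :+ con (+ 2) :* z) refl r b z h (u * u) ⟩
      r * r + φ (+ 2) * z
        ≈⟨ x≈ ⟨
      x ∎)
    where
    A = sum a
    b = proj₁ (square-of-sum a a∈)
    h = φ (+ q)
    s = r - φ (+ 1)
    u = A * s
    w₀ = φ (+ 1) - u * A
    -- As `A² = 2 b - 1`, the coordinate `w₀` equals `r - 2 b s`. The untranslated vector therefore
    -- has the value `r² - 4 b s (r - b s) + 2 q u²`, and `t` is half of what separates this from
    -- `r² + 2 z`.
    t = z - h * (u * u) + φ (+ 2) * (b * s * (r - b * s))

    A∈ = sum-integral a a∈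
    b∈ = proj₁ (proj₂ (square-of-sum a a∈))
    s∈ = integral-- r∈ (integral-φ (+ 1))
    u∈ = integral-* A∈ s∈
    t∈ = integral-+ (integral-- z∈ (integral-* (integral-φ (+ q)) (integral-* u∈ u∈)))
      (integral-* (integral-φ (+ 2))
        (integral-* (integral-* b∈ s∈) (integral-- r∈ (integral-* b∈ s∈))))

    2q≈ : φ (+ (q ℕ.* 2)) ≈ h * φ (+ 2)
    2q≈ = trans (reflexive (≡.cong φ (ℤ.pos-* q 2))) (φ.*-homo (+ q) (+ 2))

    A²≈ : A * A ≈ - 1# + φ (+ 2) * b
    A²≈ = trans (proj₂ (proj₂ (square-of-sum a a∈))) (+-congʳ (sym -1≈))

    w₀≈ : φ (+ 1) - A * A * s ≈ φ (+ 1) - (- 1# + φ (+ 2) * b) * s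
    w₀≈ = +-congˡ (-‿cong (*-congʳ A²≈))

  -- Denominators with respect to the order

  order-isSubmodule : ∀ {u v} → IsSubmodule ℤ[ u , v ]
  order-isSubmodule = record
    { resp∈ = resp
    ; zero∈ = resp φ.0#-homo (int (+ 0))
    ; add∈ = add
    ; scale∈ = λ k → mul (int k)
    }

  module _ {u v : Carrier} where

    Denominator : Carrier → Set (c ⊔ ℓ)
    Denominator x = ∃[ n ] ℤ[ u , v ] (φ (+ suc n) * x)

    private
      φ-*-suc : ∀ m n → φ (+ (suc m ℕ.* suc n)) ≈ φ (+ suc m) * φ (+ suc n)
      φ-*-suc m n = trans (reflexive (≡.cong φ (ℤ.pos-* (suc m) (suc n)))) (φ.*-homo (+ suc m) (+ suc n))

    denominator-+ : ∀ {x y} → Denominator x → Denominator y → Denominator (x + y)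
    -- The witness is the predecessor of `suc m * suc n`, since a denominator is stored as its
    -- predecessor to keep it positive.
    denominator-+ {x} {y} (m , mx∈) (n , ny∈) = n ℕ.+ m ℕ.* suc n ,
      resp (begin
        φ (+ suc n) * (φ (+ suc m) * x) + φ (+ suc m) * (φ (+ suc n) * y)
          ≈⟨ solve 4 (λ m n x y → n :* (m :* x) :+ m :* (n :* y) := m :* n :* (x :+ y)) refl (φ (+ suc m)) (φ (+ suc n)) x y ⟩
        φ (+ suc m) * φ (+ suc n) * (x + y)
          ≈⟨ *-congʳ (φ-*-suc m n) ⟨
        φ (+ (suc m ℕ.* suc n)) * (x + y) ∎)
      (add (mul (int (+ suc n)) mx∈) (mul (int (+ suc m)) ny∈))

    denominator-* : ∀ {x y} → Denominator x → Denominator y → Denominator (x * y)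
    denominator-* {x} {y} (m , mx∈) (n , ny∈) = n ℕ.+ m ℕ.* suc n ,
      resp (begin
        φ (+ suc m) * x * (φ (+ suc n) * y)
          ≈⟨ solve 4 (λ m n x y → m :* x :* (n :* y) := m :* n :* (x :* y)) refl (φ (+ suc m)) (φ (+ suc n)) x y ⟩
        φ (+ suc m) * φ (+ suc n) * (x * y)
          ≈⟨ *-congʳ (φ-*-suc m n) ⟨
        φ (+ (suc m ℕ.* suc n)) * (x * y) ∎)
      (mul mx∈ ny∈)

    denominator-neg : ∀ {x} → Denominator x → Denominator (- x)
    denominator-neg {x} (n , nx∈) = n ,
      resp (solve 2 (λ n x → :- (n :* x) := n :* (:- x)) refl (φ (+ suc n)) x) (neg nx∈)

    denominator-resp : ∀ {x y} → x ≈ y → Denominator x → Denominator y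
    denominator-resp x≈y (n , nx∈) = n , resp (*-congˡ x≈y) nx∈

    order⇒denominator : ∀ {x} → ℤ[ u , v ] x → Denominator x
    order⇒denominator {x} x∈ = 0 , mul (int (+ 1)) x∈

    module _ (cancel : ∀ n {x y} → φ (+ suc n) * x ≈ φ (+ suc n) * y → x ≈ y) where

      -- The lowest nonzero coefficient of an integral equation of x is a
      -- denominator of n / x.
      denominator-quotient : ∀ {x y} n d (a : Vector ℤ d) →
        x ^ d + sum (λ i → φ (a i) * x ^ toℕ i) ≈ 0# →
        ℤ[ u , v ] x → x * y ≈ φ (+ suc n) → Denominator y
      -- An equation of degree zero says that 1 is 0, so `y` is 0 as well.
      denominator-quotient {x} {y} n zero a eq x∈ xy≈n =
        order⇒denominator (resp (begin
          φ (+ 0)         ≈⟨ φ.0#-homo ⟩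
          0#              ≈⟨ zeroˡ y ⟨
          0# * y          ≈⟨ *-congʳ eq ⟨
          (1# + 0#) * y   ≈⟨ *-congʳ (+-identityʳ 1#) ⟩
          1# * y          ≈⟨ *-identityˡ y ⟩
          y               ∎) (int (+ 0)))
      denominator-quotient {x} {y} n (suc d) a eq x∈ xy≈n = by-constant (a zero) ≡.refl
        where
        w = x ^ d + sum (λ i → φ (a (suc i)) * x ^ toℕ i)
        N = φ (+ suc n)

        w∈ : ℤ[ u , v ] w
        w∈ = add (power d x∈) (IsSubmodule.sum∈ order-isSubmodule
          (λ i → φ (a (suc i)) * x ^ toℕ i) (λ i → mul (int (a (suc i))) (power (toℕ i) x∈)))

        xw≈ : x * w + φ (a zero) ≈ 0#
        xw≈ = begin
          x * w + φ (a zero)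
            ≈⟨ +-congʳ (distribˡ x (x ^ d) (sum (λ i → φ (a (suc i)) * x ^ toℕ i))) ⟩
          x ^ suc d + x * sum (λ i → φ (a (suc i)) * x ^ toℕ i) + φ (a zero)
            ≈⟨ +-congʳ (+-congˡ (trans (*-distribˡ-sum x (λ i → φ (a (suc i)) * x ^ toℕ i))
                 (sum-cong (λ i → x * (φ (a (suc i)) * x ^ toℕ i)) (λ i → φ (a (suc i)) * x ^ suc (toℕ i))
                   (λ i → solve 3 (λ x a p → x :* (a :* p) := a :* (x :* p)) refl x (φ (a (suc i))) (x ^ toℕ i))))) ⟩
          x ^ suc d + sum (λ i → φ (a (suc i)) * x ^ suc (toℕ i)) + φ (a zero)
            ≈⟨ solve 3 (λ p s a → p :+ s :+ a := p :+ (a :* :1 :+ s)) refl (x ^ suc d) (sum (λ i → φ (a (suc i)) * x ^ suc (toℕ i))) (φ (a zero)) ⟩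
          x ^ suc d + (φ (a zero) * 1# + sum (λ i → φ (a (suc i)) * x ^ suc (toℕ i)))
            ≈⟨ eq ⟩
          0# ∎

        -- Here `x * w` is minus the constant coefficient; multiplying by `y` turns `x` into `N`, so
        -- a multiple of `y` by an integer lies in the order.
        Nw≈ : ∀ k → a zero ≡ k → N * w ≈ - (φ k * y)
        Nw≈ k ≡.refl = begin
          N * w                                     ≈⟨ *-congʳ xy≈n ⟨
          x * y * w                                 ≈⟨ solve 4 (λ x y w a → x :* y :* w := (x :* w :+ a) :* y :- a :* y) refl x y w (φ k) ⟩
          (x * w + φ k) * y - φ k * y               ≈⟨ +-congʳ (trans (*-congʳ xw≈) (zeroˡ y)) ⟩
          0# - φ k * y                              ≈⟨ +-identityˡ (- (φ k * y)) ⟩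
          - (φ k * y)                               ∎

        by-constant : ∀ k → a zero ≡ k → Denominator y
        -- Now `N * w` vanishes, hence so does `w`, which is a monic equation of one degree less.
        -- The factor `x` is removed through `y` without dividing by it.
        by-constant (+ zero) a₀≡ =
          denominator-quotient n d (a ∘ suc) (cancel n (begin
            N * w            ≈⟨ Nw≈ (+ 0) a₀≡ ⟩
            - (φ (+ 0) * y)  ≈⟨ solve 2 (λ y n → :- (con (+ 0) :* y) := n :* con (+ 0)) refl y N ⟩
            N * φ (+ 0)      ≈⟨ *-congˡ φ.0#-homo ⟩
            N * 0#           ∎)) x∈ xy≈n
        by-constant (+ suc k) a₀≡ = k ,
          resp (trans (-‿cong (Nw≈ (+ suc k) a₀≡)) (-‿involutive (φ (+ suc k) * y)))
            (neg (mul (int (+ suc n)) w∈))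
        by-constant -[1+ k ] a₀≡ = k ,
          resp (begin
            N * w                 ≈⟨ Nw≈ -[1+ k ] a₀≡ ⟩
            - (φ -[1+ k ] * y)    ≈⟨ -‿cong (*-congʳ (φ.-‿homo (+ suc k))) ⟩
            - (- φ (+ suc k) * y) ≈⟨ solve 2 (λ n y → :- ((:- n) :* y) := n :* y) refl (φ (+ suc k)) y ⟩
            φ (+ suc k) * y       ∎)
          (mul (int (+ suc n)) w∈)

      -- Clearing the denominator of `x` moves it to the right of `x * y ≈ 1#`; this is why the
      -- quotient is taken of an integer `suc n`.
      denominator-inverse : ∀ {x y} → (∀ {z} → ℤ[ u , v ] z → Integral z) →
        x * y ≈ 1# → Denominator x → Denominator y
      denominator-inverse {x} {y} integral xy≈1 (n , nx∈) =
        let d , a , eq = integral nx∈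
        in denominator-quotient n d a eq nx∈
          (trans (*-assoc (φ (+ suc n)) x y) (trans (*-congˡ xy≈1) (*-identityʳ (φ (+ suc n)))))

-- Least witnesses, and the integers inside the field `K`

open import Defs

-- If there were no least witness, no `j` below `b` could satisfy `P`, by induction; but then `b`
-- itself would be least.
¬¬-least : ∀ {p} {P : ℕ → Set p} b → Acc _<_ b → 0 < b → P b →
  ¬ ¬ (∃[ g ] (IsLeastPositive P g × g ≤ b))
¬¬-least b (acc rec) 0<b Pb none = none
  (b , (0<b , Pb , λ j 0<j Pj → ℕ.≮⇒≥ (λ j<b → ¬¬-least j (rec j<b) 0<j Pj
    λ { (g , g-least , g≤j) → none (g , g-least , ℕ.≤-trans g≤j (ℕ.<⇒≤ j<b)) })) , ℕ.≤-refl)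

-- `fromℚᵘ` cancels common factors, so the two sides are compared after `toℚᵘ`, up to equivalence of
-- unnormalised fractions.
fromℚᵘ-homo-+ : ∀ p q → ℚ.fromℚᵘ (p ℚᵘ.+ q) ≡ ℚ.fromℚᵘ p ℚ.+ ℚ.fromℚᵘ q
fromℚᵘ-homo-+ p q = ℚ.toℚᵘ-injective (ℚᵘ.≃-trans (ℚ.toℚᵘ-fromℚᵘ (p ℚᵘ.+ q)) (ℚᵘ.≃-sym
  (ℚᵘ.≃-trans (ℚ.toℚᵘ-homo-+ (ℚ.fromℚᵘ p) (ℚ.fromℚᵘ q))
    (ℚᵘ.+-cong (ℚ.toℚᵘ-fromℚᵘ p) (ℚ.toℚᵘ-fromℚᵘ q)))))

fromℚᵘ-homo-* : ∀ p q → ℚ.fromℚᵘ (p ℚᵘ.* q) ≡ ℚ.fromℚᵘ p ℚ.* ℚ.fromℚᵘ q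
fromℚᵘ-homo-* p q = ℚ.toℚᵘ-injective (ℚᵘ.≃-trans (ℚ.toℚᵘ-fromℚᵘ (p ℚᵘ.* q)) (ℚᵘ.≃-sym
  (ℚᵘ.≃-trans (ℚ.toℚᵘ-homo-* (ℚ.fromℚᵘ p) (ℚ.fromℚᵘ q))
    (ℚᵘ.*-cong (ℚ.toℚᵘ-fromℚᵘ p) (ℚ.toℚᵘ-fromℚᵘ q)))))

fromℚᵘ-homo-neg : ∀ p → ℚ.fromℚᵘ (ℚᵘ.- p) ≡ ℚ.- ℚ.fromℚᵘ p
fromℚᵘ-homo-neg p = ℚ.toℚᵘ-injective (ℚᵘ.≃-trans (ℚ.toℚᵘ-fromℚᵘ (ℚᵘ.- p)) (ℚᵘ.≃-sym
  (ℚᵘ.≃-trans (ℚ.toℚᵘ-homo‿- (ℚ.fromℚᵘ p)) (ℚᵘ.-‿cong (ℚ.toℚᵘ-fromℚᵘ p)))))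

module _ {c ℓ₁ ℓ₂ : Level} (K : FieldOverℚ c ℓ₁ ℓ₂) where

  open FieldOverℚ K hiding (zero)
  private
    module R = CommutativeRing commutativeRing
    module ι = IsRingHomomorphism ι-isRingHomomorphism

    integer : ℤ → ℚᵘ
    integer k = mkℚᵘ k 0

    ι-≡ : ∀ {p q} → p ≡ q → ι p ≈ ι q
    ι-≡ p≡q = R.reflexive (≡.cong ι p≡q)

  fromℤ-+ : ∀ i j → fromℤ (i ℤ.+ j) ≈ fromℤ i + fromℤ j
  fromℤ-+ i j = R.trans
    (ι-≡ (≡.trans
      (ℚ.fromℚᵘ-cong {integer (i ℤ.+ j)} {integer i ℚᵘ.+ integer j}
        (*≡* (≡.cong (ℤ._* + 1) (≡.sym (≡.cong₂ ℤ._+_ (ℤ.*-identityʳ i) (ℤ.*-identityʳ j))))))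
      (fromℚᵘ-homo-+ (integer i) (integer j))))
    (ι.+-homo (i ℚ./ 1) (j ℚ./ 1))

  fromℤ-* : ∀ i j → fromℤ (i ℤ.* j) ≈ fromℤ i * fromℤ j
  fromℤ-* i j = R.trans
    (ι-≡ (fromℚᵘ-homo-* (integer i) (integer j)))
    (ι.*-homo (i ℚ./ 1) (j ℚ./ 1))

  fromℤ-neg : ∀ i → fromℤ (ℤ.- i) ≈ - fromℤ i
  fromℤ-neg i = R.trans (ι-≡ (fromℚᵘ-homo-neg (integer i))) (ι.-‿homo (i ℚ./ 1))

  fromℤ-isRingHomomorphism : IsRingHomomorphism ℤ.+-*-rawRing rawRing fromℤ
  fromℤ-isRingHomomorphism = record
    { isSemiringHomomorphism = record
      { isNearSemiringHomomorphism = record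
        { +-isMonoidHomomorphism = record
          { isMagmaHomomorphism = record
            { isRelHomomorphism = record { cong = λ { ≡.refl → R.refl } }
            ; homo = fromℤ-+
            }
          ; ε-homo = ι.0#-homo
          }
        ; *-homo = fromℤ-*
        }
      ; 1#-homo = ι.1#-homo
      }
    ; -‿homo = fromℤ-neg
    }

  open Integrality commutativeRing fromℤ fromℤ-isRingHomomorphism hiding (Integral)
  open Solver using (solve; con; _:=_; _:+_; _:*_; _:-_)
  open SetoidReasoning R.setoid

  1/suc : ℕ → Carrier
  1/suc n = ι (+ 1 ℚ./ suc n)

  1/suc-inverse : ∀ n → 1/suc n * fromℤ (+ suc n) ≈ 1#
  1/suc-inverse n = R.trans (R.sym (ι.*-homo (+ 1 ℚ./ suc n) (+ suc n ℚ./ 1)))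
    (R.trans (ι-≡ (≡.trans (≡.sym (fromℚᵘ-homo-* (mkℚᵘ (+ 1) n) (integer (+ suc n))))
      (ℚ.fromℚᵘ-cong {mkℚᵘ (+ 1) n ℚᵘ.* integer (+ suc n)} {integer (+ 1)}
        (*≡* (≡.trans (ℤ.*-identityʳ (+ 1 ℤ.* + suc n)) (≡.cong (λ k → + 1 ℤ.* + k) (≡.sym (ℕ.*-identityʳ (suc n)))))))))
      ι.1#-homo)

  fromℤ-cancel : ∀ n {x y} → fromℤ (+ suc n) * x ≈ fromℤ (+ suc n) * y → x ≈ y
  fromℤ-cancel n {x} {y} eq = begin
    x                                ≈⟨ unfold x ⟨
    1/suc n * (fromℤ (+ suc n) * x)  ≈⟨ R.*-congˡ eq ⟩
    1/suc n * (fromℤ (+ suc n) * y)  ≈⟨ unfold y ⟩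
    y                                ∎
    where
    unfold : ∀ z → 1/suc n * (fromℤ (+ suc n) * z) ≈ z
    unfold z = R.trans (R.sym (R.*-assoc (1/suc n) (fromℤ (+ suc n)) z))
      (R.trans (R.*-congʳ (1/suc-inverse n)) (R.*-identityˡ z))

  rational-denominator : ∀ q → fromℤ (ℚ.↧ q) * ι q ≈ fromℤ (ℚ.↥ q)
  rational-denominator q@(mkℚ n d-1 _) = R.trans (R.sym (ι.*-homo (ℚ.↧ q ℚ./ 1) q))
    (ι-≡ (≡.trans (≡.cong ((ℚ.↧ q ℚ./ 1) ℚ.*_) (≡.sym (ℚ.fromℚᵘ-toℚᵘ q)))
      (≡.trans (≡.sym (fromℚᵘ-homo-* (integer (ℚ.↧ q)) (mkℚᵘ n d-1)))
        (ℚ.fromℚᵘ-cong {integer (ℚ.↧ q) ℚᵘ.* mkℚᵘ n d-1} {integer n}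
          (*≡* (≡.trans (ℤ.*-identityʳ (ℚ.↧ q ℤ.* n)) (≡.trans (ℤ.*-comm (ℚ.↧ q) n)
            (≡.cong (λ k → n ℤ.* + k) (≡.sym (ℕ.*-identityˡ (suc d-1)))))))))))

  -- The elements (1 + r)/2, where `1/suc 1` is one half

  half-integer : Carrier → Carrier
  half-integer r = 1/suc 1 * (1# + r)

  double-half : ∀ r → fromℤ (+ 2) * half-integer r ≈ 1# + r
  double-half r = begin
    fromℤ (+ 2) * (1/suc 1 * (1# + r))  ≈⟨ R.*-assoc (fromℤ (+ 2)) (1/suc 1) (1# + r) ⟨
    fromℤ (+ 2) * 1/suc 1 * (1# + r)    ≈⟨ R.*-congʳ (R.trans (R.*-comm (fromℤ (+ 2)) (1/suc 1)) (1/suc-inverse 1)) ⟩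
    1# * (1# + r)                       ≈⟨ R.*-identityˡ (1# + r) ⟩
    1# + r                              ∎

  -- Four times the square is `(1 + r)² = r² + 2 (1 + r) - 1`. A square `r²` that is 1 modulo 4
  -- cancels the `- 1` and leaves a multiple of 4, which `fromℤ-cancel 3` divides out.
  half-integer-quadratic : ∀ {r} k → r * r ≈ fromℤ (+ 1 ℤ.+ + 4 ℤ.* k) →
    half-integer r * half-integer r ≈ half-integer r + fromℤ k
  half-integer-quadratic {r} k r²≈ = fromℤ-cancel 3 (begin
    fromℤ (+ 4) * (α * α)
      ≈⟨ solve 1 (λ α → con (+ 4) :* (α :* α) := (con (+ 2) :* α) :* (con (+ 2) :* α)) R.refl α ⟩
    (fromℤ (+ 2) * α) * (fromℤ (+ 2) * α)
      ≈⟨ R.*-cong (double-half r) (double-half r) ⟩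
    (1# + r) * (1# + r)
      ≈⟨ solve 1 (λ r → (:1 :+ r) :* (:1 :+ r) := r :* r :+ con (+ 2) :* (:1 :+ r) :- con (+ 1)) R.refl r ⟩
    r * r + fromℤ (+ 2) * (1# + r) - fromℤ (+ 1)
      ≈⟨ R.+-congʳ (R.+-cong
           (R.trans r²≈ (R.trans (fromℤ-+ (+ 1) (+ 4 ℤ.* k)) (R.+-congˡ (fromℤ-* (+ 4) k))))
           (R.*-congˡ (R.sym (double-half r)))) ⟩
    fromℤ (+ 1) + fromℤ (+ 4) * fromℤ k + fromℤ (+ 2) * (fromℤ (+ 2) * α) - fromℤ (+ 1)
      ≈⟨ solve 2 (λ α k → con (+ 1) :+ con (+ 4) :* k :+ con (+ 2) :* (con (+ 2) :* α) :- con (+ 1) := con (+ 4) :* (α :+ k)) R.refl α (fromℤ k) ⟩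
    fromℤ (+ 4) * (α + fromℤ k) ∎)
    where α = half-integer r

  -- Pads an odd number of squares to an even one, at the cost of one more summand in the bound.
  append-zero : ∀ {s x} → IsSumOfIntegralSquares K s x → IsSumOfIntegralSquares K (suc s) x
  append-zero (a , a∈ , x≈) = 0# ∷ a ,
    (λ { zero → integral-0 ; (suc i) → a∈ i }) ,
    R.trans x≈ (R.sym (R.trans (R.+-congʳ (R.zeroˡ 0#)) (R.+-identityˡ (sum (λ i → a i * a i)))))

  -- The field generated by two square roots

  module _ (k l : ℤ) (roots : IsℚAdjoinSquareRoots K (+ 1 ℤ.+ + 4 ℤ.* k) (+ 1 ℤ.+ + 4 ℤ.* l)) where
    open IsℚAdjoinSquareRoots roots

    private
      α = half-integer √a
      β = half-integer √b

    open QuadraticOrder {α} {β} {k} {l}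
      (half-integer-quadratic k √a-square) (half-integer-quadratic l √b-square)

    root∈order : ∀ r → ℤ[ α , β ] (half-integer r) → ℤ[ α , β ] r
    root∈order r r∈ = resp (begin
      fromℤ (+ 2) * half-integer r - 1#  ≈⟨ R.+-congʳ (double-half r) ⟩
      (1# + r) - 1#                      ≈⟨ solve 1 (λ r → :1 :+ r :- :1 := r) R.refl r ⟩
      r                                  ∎)
      (add (mul (int (+ 2)) r∈) (neg one))

    -- Induction on how `x` is generated. Only `inv` goes beyond arithmetic of fractions: it uses
    -- that members of the order are integral.
    field-denominator : ∀ {x} → ℚ⟨_,_⟩ K √a √b x → Denominator {α} {β} x
    field-denominator (rational q@(mkℚ n d-1 _)) =
      d-1 , resp (R.sym (rational-denominator q)) (int n)
    field-denominator left = order⇒denominator (root∈order √a left)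
    field-denominator right = order⇒denominator (root∈order √b right)
    field-denominator (add x∈ y∈) =
      denominator-+ (field-denominator x∈) (field-denominator y∈)
    field-denominator (neg x∈) = denominator-neg (field-denominator x∈)
    field-denominator (mul x∈ y∈) =
      denominator-* (field-denominator x∈) (field-denominator y∈)
    field-denominator (inv xy≈1 x∈) =
      denominator-inverse fromℤ-cancel order⇒integral xy≈1 (field-denominator x∈)
    field-denominator (resp x≈y x∈) = denominator-resp x≈y (field-denominator x∈)

    sums-of-squares : ∀ q → IsSumOfIntegralSquares K (q ℕ.* 2) (- 1#) →
      ∀ x → Integral K x → IsSumOfIntegralSquares K (suc (q ℕ.* 2)) x
    sums-of-squares q (a , a∈ , -1≈) x x∈ =
      let n , nx∈ = field-denominator (generate x)
          z , z∈ , x≈ = square-mod-2 (fromℤ-cancel 1) n x∈ nx∈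
      -- The square root of `x` modulo 2 is `r = x * x`, because `x ≡ x⁴`. For `fromℤ`, integrality
      -- and sums of squares over a general ring unfold to the notions of the theorem.
      in sum-of-squares q a a∈ -1≈ (integral-* x∈ x∈) z∈ x≈

    g≤-even : ∀ s → 2 ∣ s → IsSumOfIntegralSquares K s (- 1#) → g≤ K (suc s)
    g≤-even _ (divides q ≡.refl) -1-sum =
      (suc (q ℕ.* 2) , ℕ.z<s , ℕ.≤-refl , sums-of-squares q -1-sum) ,
      ¬¬-least (suc (q ℕ.* 2)) (<-wellFounded (suc (q ℕ.* 2))) ℕ.z<s (sums-of-squares q -1-sum)

-- Parity of the level, and the congruences modulo 4

n+n≡n*2 : ∀ n → n ℕ.+ n ≡ n ℕ.* 2
n+n≡n*2 n = ≡.trans (≡.cong (n ℕ.+_) (≡.sym (ℕ.+-identityʳ n))) (ℕ.*-comm 2 n)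

2∤n⇒2∣1+n : ∀ n → ¬ (2 ∣ n) → 2 ∣ suc n
2∤n⇒2∣1+n n 2∤n with parity n
... | e , inj₁ eq = contradiction (divides e (≡.trans eq (n+n≡n*2 e))) 2∤n
... | e , inj₂ eq = divides (suc e) (≡.cong suc (≡.trans eq (≡.cong suc (n+n≡n*2 e))))

open import Data.Integer.Base using (-_)
open import Data.Nat.Base using (_+_; _%_)

theorem1p2 : ∀ {c ℓ₁ ℓ₂} (m n : ℕ) →
    0 < m → 0 < n → m ≢ n →
    m % 4 ≡ 3 → n % 4 ≡ 1 →
    Squarefree m → Squarefree n →
    (K : FieldOverℚ c ℓ₁ ℓ₂) → IsℚAdjoinSquareRoots K (- (+ m)) (+ n) →
    ∀ s → IsLevel K s →
    (2 ∣ s → g≤ K (s + 1)) × (¬ (2 ∣ s) → g≤ K (s + 2))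
theorem1p2 m n _ _ _ m%4≡3 n%4≡1 _ _ K roots s (_ , -1-sum , _) =
  (λ 2∣s → ≡.subst (g≤ K) (ℕ.+-comm 1 s) (g≤-even K k l roots′ s 2∣s -1-sum)) ,
  (λ 2∤s → ≡.subst (g≤ K) (ℕ.+-comm 2 s)
    (g≤-even K k l roots′ (suc s) (2∤n⇒2∣1+n s 2∤s) (append-zero K -1-sum)))
  where
  open ℤ.+-*-Solver

  -- From `m = 3 + 4 q` follows `- m = 1 + 4 (- (1 + q))`, with `q = m / 4`.
  k = ℤ.- (+ suc (m / 4))
  l = + (n / 4)

  -m≡ : - (+ m) ≡ + 1 ℤ.+ + 4 ℤ.* k
  -m≡ = ≡.trans (≡.cong (λ k → - (+ k)) (m≡m%n+[m/n]*n m 4))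
    (≡.trans (≡.cong₂ (λ r p → - (+ r ℤ.+ p)) m%4≡3 (ℤ.pos-* (m / 4) 4))
      (solve 1 (λ q → :- (con (+ 3) :+ q :* con (+ 4)) :=
        con (+ 1) :+ con (+ 4) :* :- (con (+ 1) :+ q)) ≡.refl (+ (m / 4))))

  n≡ : + n ≡ + 1 ℤ.+ + 4 ℤ.* l
  n≡ = ≡.trans (≡.cong +_ (m≡m%n+[m/n]*n n 4))
    (≡.cong₂ ℤ._+_ (≡.cong +_ n%4≡1)
      (≡.trans (ℤ.pos-* (n / 4) 4) (ℤ.*-comm (+ (n / 4)) (+ 4))))

  roots′ : IsℚAdjoinSquareRoots K (+ 1 ℤ.+ + 4 ℤ.* k) (+ 1 ℤ.+ + 4 ℤ.* l)
  roots′ = ≡.subst₂ (IsℚAdjoinSquareRoots K) -m≡ n≡ roots
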